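{- If $G$ is a maximal outerplane graph whose weak-dual is a path, then $\overrightarrow{\chi}(G)\leq 13$.
   Context: An orientation $D$ of a graph $G$ replaces each edge by exactly one of its two possible arcs; $d^-_D(v)$ is the indegree of $v$. $D$ is proper if adjacent vertices have distinct indegrees; a $k$-orientation has maximum indegree at most $k$. $\overrightarrow{\chi}(G)$ is the minimum $k$ such that $G$ admits a proper $k$-orientation. A graph is maximal outerplanar if it is outerplanar and no edge can be added keeping it outerplanar; a maximal outerplane graph is an outerplanar embedding of such a graph (all vertices on the outer face). The weak-dual is the dual graph with the vertex corresponding to the outer face removed. -}

module Defs where

open import Data.Nat using (ℕ; zero; suc; _≤_)
open import Data.Fin using (Fin; toℕ; _<_)
open import Data.Bool using (Bool; true; false; if_then_else_)
open import Data.List using (List; map; allFin)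
open import Data.Nat.ListAction using (sum)
open import Data.Product using (Σ; ∃; _×_; _,_)
open import Data.Sum using (_⊎_)
open import Relation.Nullary using (¬_)
open import Function.Definitions using (Injective)
open import Relation.Binary.PropositionalEquality using (_≡_; _≢_)

record Graph (n : ℕ) : Set where
  field
    adj   : Fin n → Fin n → Bool
    sym   : ∀ u v → adj u v ≡ adj v u
    irref : ∀ v → adj v v ≡ false

open Graph public

Edge : ∀ {n} → Graph n → Fin n → Fin n → Set
Edge G u v = adj G u v ≡ true

record Orientation {n : ℕ} (G : Graph n) : Set where
  field
    arc      : Fin n → Fin n → Bool
    arc-edge : ∀ u v → arc u v ≡ true → Edge G u v
    one-way  : ∀ u v → Edge G u v →
               (arc u v ≡ true × arc v u ≡ false) ⊎ (arc u v ≡ false × arc v u ≡ true)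

open Orientation public

indeg : ∀ {n} {G : Graph n} → Orientation G → Fin n → ℕ
indeg {n} D v = sum (map (λ u → if arc D u v then 1 else 0) (allFin n))

IsProperKOrientation : ∀ {n} {G : Graph n} → ℕ → Orientation G → Set
IsProperKOrientation {n} {G} k D =
  (∀ u v → Edge G u v → indeg D u ≢ indeg D v) × (∀ v → indeg D v ≤ k)

ProperOrientationNumber≤ : ∀ {n} → Graph n → ℕ → Set
ProperOrientationNumber≤ G k = Σ (Orientation G) (IsProperKOrientation k)

-- Outerplane embeddings, combinatorially: vertices placed in convex
-- position on a circle; pos v is the position of v along the outer face.
-- Edges are straight chords; a drawing is outerplane iff no two edges cross.

Sep : ℕ → ℕ → ℕ → ℕ → Set
Sep a b c d = (a Data.Nat.< c) × (c Data.Nat.< b) × (b Data.Nat.< d)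

CrossOrd : ℕ → ℕ → ℕ → ℕ → Set
CrossOrd u v x y = Sep u v x y ⊎ Sep v u x y ⊎ Sep u v y x ⊎ Sep v u y x

Cross : ℕ → ℕ → ℕ → ℕ → Set
Cross u v x y = CrossOrd u v x y ⊎ CrossOrd x y u v

record MaximalOuterplane {n : ℕ} (G : Graph n) : Set where
  field
    pos       : Fin n → Fin n
    pos-inj   : Injective _≡_ _≡_ pos
    noncross  : ∀ u v x y → Edge G u v → Edge G x y →
                ¬ Cross (toℕ (pos u)) (toℕ (pos v)) (toℕ (pos x)) (toℕ (pos y))
    maximal   : ∀ u v → u ≢ v → adj G u v ≡ false →
                ∃ λ x → ∃ λ y → Edge G x y ×
                  Cross (toℕ (pos u)) (toℕ (pos v)) (toℕ (pos x)) (toℕ (pos y))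

-- Inner faces of a maximal outerplane graph and its weak dual.
-- In a maximal outerplane graph the inner (bounded) faces are exactly the
-- triangles of G; a face is recorded as its vertex triple (a , b , c)
-- with a < b < c (in the order of Fin n), so each face has one name.

Triple : ℕ → Set
Triple n = Fin n × Fin n × Fin n

IsFace : ∀ {n} → Graph n → Triple n → Set
IsFace G (a , b , c) = (a < b) × (b < c) × Edge G a b × Edge G b c × Edge G a c

_∈▵_ : ∀ {n} → Fin n → Triple n → Set
v ∈▵ (a , b , c) = v ≡ a ⊎ v ≡ b ⊎ v ≡ c

-- two distinct inner faces are adjacent in the weak dual iff they share
-- an edge, i.e. two distinct vertices
DualAdj : ∀ {n} → Triple n → Triple n → Set
DualAdj t s = t ≢ s × ∃ λ u → ∃ λ v → u ≢ v × u ∈▵ t × v ∈▵ t × u ∈▵ s × v ∈▵ s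

WeakDualIsPath : ∀ {n} → Graph n → Set
WeakDualIsPath {n} G =
  Σ ℕ λ m → Σ (Fin m → Triple n) λ f →
    (∀ i → IsFace G (f i)) ×
    Injective _≡_ _≡_ f ×
    (∀ t → IsFace G t → ∃ λ i → f i ≡ t) ×
    (∀ i j → (DualAdj (f i) (f j) → (toℕ j ≡ suc (toℕ i) ⊎ toℕ i ≡ suc (toℕ j)))
           × ((toℕ j ≡ suc (toℕ i) ⊎ toℕ i ≡ suc (toℕ j)) → DualAdj (f i) (f j)))

{-# OPTIONS --safe #-}

-- The triangles along the dual path form a strip: each one is glued to the newest vertex of its
-- predecessor and to one of the two other corners, and brings in a vertex not seen before (the
-- shared edge separates it from everything earlier).  Reading the strip triangle by triangle, an
-- oriented prefix matters only through the current and the intended indegree of the three newest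
-- corners, so a finite automaton can keep track of configurations which are all attainable.
-- Maximum indegree 4 turns out to be enough.

module Submission where

open import Algebra.Properties.CommutativeSemigroup using (interchange)
open import Data.Bool using (Bool; true; false; not; if_then_else_)
open import Data.Bool.Properties as Bool using (¬-not)
open import Data.Empty using (⊥)
open import Data.Fin as Fin using (Fin; zero; suc; toℕ; fromℕ<; fromℕ; punchOut; #_)
open import Data.Fin.Induction using (>-wellFounded)
open import Data.Fin.Properties as Fin
  using (_≟_; toℕ-injective; toℕ<n; toℕ-fromℕ<; toℕ-fromℕ; any?; punchOut-injective)
open import Data.List using (List; []; _∷_; map; allFin; cartesianProduct)
import Data.List.Membership.DecPropositional as DecMembership
open import Data.List.Membership.Propositional using (_∈_; _∉_; find)
open import Data.List.Membership.Propositional.Properties using (∈-allFin)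
open import Data.List.Properties using (map-cong)
open import Data.List.Relation.Binary.Pointwise using (Pointwise; []; _∷_)
open import Data.List.Relation.Unary.All as All using (All; []; _∷_)
open import Data.List.Relation.Unary.All.Properties using (All¬⇒¬Any)
open import Data.List.Relation.Unary.AllPairs using (AllPairs; []; _∷_)
open import Data.List.Relation.Unary.Any as Any using (Any; here; there)
open import Data.List.Relation.Unary.Unique.Propositional using (Unique)
open import Data.List.Relation.Unary.Unique.Propositional.Properties using (allFin⁺)
open import Data.Nat using (ℕ; zero; suc; _+_; _∸_; _≤_; _<_; _≤?_; z≤n; s≤s; s≤s⁻¹)
open import Data.Nat.Induction using (<-wellFounded)
open import Data.Nat.ListAction using (sum)
import Data.Nat.Properties as ℕ
open import Data.Product using (_×_; _,_; ∃; ∃₂; proj₁; proj₂; swap)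
open import Data.Product.Properties using (≡-dec)
open import Data.Sum as Sum using (_⊎_; inj₁; inj₂; [_,_]′)
open import Data.Vec using (lookup; []; _∷_)
open import Data.Vec.Functional using (updateAt)
open import Data.Vec.Functional.Properties using (updateAt-updates; updateAt-minimal)
open import Defs hiding (sym)
open import Function using (_∘_; const; id; mk⇔)
open import Function.Definitions using (Injective)
open import Induction.WellFounded using (Acc; acc)
open import Relation.Binary.Definitions using (tri<; tri≈; tri>)
open import Relation.Binary.PropositionalEquality
  using (_≡_; _≢_; refl; sym; trans; cong; cong₂; subst; subst₂; ≢-sym; module ≡-Reasoning)
open import Relation.Nullary using (¬_; Dec; yes; no; does; contradiction)
open import Relation.Nullary.Decidable using (_×-dec_; ¬?; from-yes; dec-true; dec-false; does-⇔)

-- A vertex that stays a corner for long, the pivot of a fan, can have arbitrarily large degree. Its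
-- final indegree therefore has to be promised when it enters the strip, before its later edges are
-- known. This is why a target stands beside the current indegree, and why properness is demanded of
-- targets. Which promises can be kept depends on the triangles still to come: a corner short of its
-- target must not be dropped. So no choice is made while reading. Each automaton state carries a
-- list of configurations, every one of them realised by some orientation of the same prefix, and
-- one of them is selected only where the strip ends. This is a subset construction, thinned out to
-- four states.
--
-- The geometry has to supply two facts about the path of triangles. A new triangle must bring in a
-- new vertex, which rests on an edge separating the circle into two sides. And the triangles must
-- exhaust the graph: on at least three vertices, maximality puts every edge into a triangle.

private variable
  n : ℕ
  a b c d u v w x y z : Fin n
  Δ Δ′ : Triple n

-- Opaque because the equality tests on its results below would otherwise unfold the search.
abstract
  injective⇒surjective : ∀ {f : Fin n → Fin n} → Injective _≡_ _≡_ f → ∀ j → ∃ λ i → f i ≡ j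
  injective⇒surjective {suc n} {f} inj j with any? (λ i → f i ≟ j)
  ... | yes hit = hit
  ... | no miss = contradiction (Fin.injective⇒≤ squeeze) ℕ.1+n≰n
    where
    miss′ : ∀ i → j ≢ f i
    miss′ i eq = miss (i , sym eq)
    squeeze : Injective _≡_ _≡_ (λ i → punchOut (miss′ i))
    squeeze {i} {i′} = inj ∘ punchOut-injective (miss′ i) (miss′ i′)

module _ (G : Graph n) where

  edge-sym : ∀ {u v} → Edge G u v → Edge G v u
  edge-sym {u} {v} uv = trans (Graph.sym G v u) uv

  edge-≢ : ∀ {u v} → Edge G u v → u ≢ v
  edge-≢ {u} uv refl with () ← trans (sym uv) (irref G u)

-- Chords of a maximal outerplane graph

module Outerplane {n} (G : Graph n) (M : MaximalOuterplane G) where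
  open MaximalOuterplane M

  p : Fin n → ℕ
  p = toℕ ∘ pos

  p-injective : ∀ {u v} → p u ≡ p v → u ≡ v
  p-injective = pos-inj ∘ toℕ-injective

  p-<⇒≢ : ∀ {u v} → p u < p v → u ≢ v
  p-<⇒≢ u<v refl = ℕ.<-irrefl refl u<v

  p-≤∧≢⇒< : ∀ {u v} → p u ≤ p v → u ≢ v → p u < p v
  p-≤∧≢⇒< u≤v u≢v = ℕ.≤∧≢⇒< u≤v (u≢v ∘ p-injective)

  vertex-at : ∀ i → i < n → ∃ λ v → p v ≡ i
  vertex-at i i<n with v , eq ← injective⇒surjective pos-inj (fromℕ< i<n) =
    v , trans (cong toℕ eq) (toℕ-fromℕ< i<n)

  -- Strictly on either side of the chord u v; only meant for p u < p v.
  In Out : Fin n → Fin n → Fin n → Set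
  In  u v x = p u < p x × p x < p v
  Out u v x = p x < p u ⊎ p v < p x

  no-crossing : ∀ {u v x y} → Edge G u v → Edge G x y → In u v x → ¬ Out u v y
  no-crossing {u} {v} {x} {y} uv xy (u<x , x<v) (inj₁ y<u) =
    noncross u v x y uv xy (inj₂ (inj₂ (inj₁ (y<u , u<x , x<v))))
  no-crossing {u} {v} {x} {y} uv xy (u<x , x<v) (inj₂ v<y) =
    noncross u v x y uv xy (inj₁ (inj₁ (u<x , x<v , v<y)))

  crossing : ∀ {u v} → p u < p v → ¬ Edge G u v → ∃₂ λ x y → Edge G x y × In u v x × Out u v y
  crossing {u} {v} u<v ¬uv with maximal u v (p-<⇒≢ u<v) (¬-not ¬uv)
  ... | x , y , xy , inj₁ (inj₁ (u<x , x<v , v<y))               = x , y , xy , (u<x , x<v) , inj₂ v<y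
  ... | x , y , xy , inj₁ (inj₂ (inj₂ (inj₁ (u<y , y<v , v<x)))) = y , x , edge-sym G xy , (u<y , y<v) , inj₂ v<x
  ... | x , y , xy , inj₂ (inj₁ (x<u , u<y , y<v))               = y , x , edge-sym G xy , (u<y , y<v) , inj₁ x<u
  ... | x , y , xy , inj₂ (inj₂ (inj₁ (y<u , u<x , x<v)))        = x , y , xy , (u<x , x<v) , inj₁ y<u
  ... | x , y , xy , inj₁ (inj₂ (inj₁ (v<x , x<u , _)))          = contradiction (ℕ.<-trans v<x x<u) (ℕ.<-asym u<v)
  ... | x , y , xy , inj₁ (inj₂ (inj₂ (inj₂ (v<y , y<u , _))))   = contradiction (ℕ.<-trans v<y y<u) (ℕ.<-asym u<v)
  ... | x , y , xy , inj₂ (inj₂ (inj₂ (inj₁ (_ , v<y , y<u))))   = contradiction (ℕ.<-trans v<y y<u) (ℕ.<-asym u<v)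
  ... | x , y , xy , inj₂ (inj₂ (inj₂ (inj₂ (_ , v<x , x<u))))   = contradiction (ℕ.<-trans v<x x<u) (ℕ.<-asym u<v)

  edge? : ∀ u v → Dec (Edge G u v)
  edge? u v = adj G u v Bool.≟ true

  edge-by-maximality : ∀ {u v} → p u < p v → (∀ {x y} → In u v x → ¬ Out u v y) → Edge G u v
  edge-by-maximality {u} {v} u<v never with edge? u v
  ... | yes uv = uv
  ... | no ¬uv with _ , _ , _ , x-in , y-out ← crossing u<v ¬uv = contradiction y-out (never x-in)

  successor : ∀ u → suc (p u) < n → ∃ λ v → p v ≡ suc (p u) × Edge G u v
  successor u u<n with v , eq ← vertex-at (suc (p u)) u<n =
    v , eq , edge-by-maximality (ℕ.≤-reflexive (sym eq))
      λ {x} (u<x , x<v) _ → ℕ.<⇒≱ (subst (p x <_) eq x<v) u<x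

  -- Starting from the successor of u, move the neighbour w of u towards v:
  -- an edge crossing the missing chord w v has to start at u.
  inner-apex : ∀ {u v z} → Edge G u v → In u v z → ∃ λ w → In u v w × Edge G u w × Edge G w v
  inner-apex {u} {v} {z} uv (u<z , z<v)
    with w , eq , uw ← successor u (ℕ.<-≤-trans (s≤s u<z) (toℕ<n (pos z))) =
    walk w (>-wellFounded (pos w)) (ℕ.≤-reflexive (sym eq) , ℕ.≤-<-trans (subst (_≤ p z) (sym eq) u<z) z<v) uw
    where
    walk : ∀ w → Acc Fin._>_ (pos w) → In u v w → Edge G u w → ∃ λ w → In u v w × Edge G u w × Edge G w v
    walk w (acc rec) (u<w , w<v) uw with edge? w v
    ... | yes wv = w , (u<w , w<v) , uw , wv
    ... | no ¬wv with crossing w<v ¬wv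
    ...   | x , y , xy , (w<x , x<v) , inj₂ v<y =
      contradiction (inj₂ v<y) (no-crossing uv xy (ℕ.<-trans u<w w<x , x<v))
    ...   | x , y , xy , (w<x , x<v) , inj₁ y<w with ℕ.<-cmp (p y) (p u)
    ...     | tri< y<u _ _ = contradiction (inj₁ y<u) (no-crossing uv xy (ℕ.<-trans u<w w<x , x<v))
    ...     | tri> _ _ u<y = contradiction (inj₂ w<x) (no-crossing uw (edge-sym G xy) (u<y , y<w))
    ...     | tri≈ _ y≡u _ with refl ← p-injective y≡u =
      walk x (rec w<x) (ℕ.<-trans u<w w<x , x<v) (edge-sym G xy)

  -- Edges x y enclosing u v are shrunk until u v is a side of the triangle inside x y.
  enclosed-apex : ∀ {u v} → Edge G u v → p u < p v →
                  ∀ x y → Acc _<_ (p y ∸ p x) → Edge G x y → p x ≤ p u → p v ≤ p y → x ≢ u ⊎ y ≢ v →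
                  ∃ λ w → Edge G u w × Edge G v w
  enclosed-apex {u} {v} uv u<v x y (acc rec) xy x≤u v≤y proper
    with inner-apex xy (enclosed proper .proj₂)
    where
    enclosed : x ≢ u ⊎ y ≢ v → ∃ (In x y)
    enclosed (inj₁ x≢u) = u , p-≤∧≢⇒< x≤u x≢u , ℕ.<-≤-trans u<v v≤y
    enclosed (inj₂ y≢v) = v , ℕ.≤-<-trans x≤u u<v , p-≤∧≢⇒< v≤y (≢-sym y≢v)
  ... | w , (x<w , w<y) , xw , wy with ℕ.≤-<-connex (p w) (p u) | ℕ.≤-<-connex (p v) (p w)
  ... | inj₁ w≤u | _ = narrow (w ≟ u) (y ≟ v)
    where
    shrink : w ≢ u ⊎ y ≢ v → ∃ λ w → Edge G u w × Edge G v w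
    shrink = enclosed-apex uv u<v w y (rec (ℕ.∸-monoʳ-< x<w (ℕ.<⇒≤ w<y))) wy w≤u v≤y
    narrow : Dec (w ≡ u) → Dec (y ≡ v) → ∃ λ w → Edge G u w × Edge G v w
    narrow (yes refl) (yes refl) = x , edge-sym G xw , edge-sym G xy
    narrow (no w≢u)   _          = shrink (inj₁ w≢u)
    narrow _          (no y≢v)   = shrink (inj₂ y≢v)
  ... | _ | inj₁ v≤w = narrow (x ≟ u) (w ≟ v)
    where
    shrink : x ≢ u ⊎ w ≢ v → ∃ λ w → Edge G u w × Edge G v w
    shrink = enclosed-apex uv u<v x w (rec (ℕ.∸-monoˡ-< w<y (ℕ.<⇒≤ x<w))) xw x≤u v≤w
    narrow : Dec (x ≡ u) → Dec (w ≡ v) → ∃ λ w → Edge G u w × Edge G v w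
    narrow (yes refl) (yes refl) = y , xy , wy
    narrow (no x≢u)   _          = shrink (inj₁ x≢u)
    narrow _          (no w≢v)   = shrink (inj₂ w≢v)
  -- An apex strictly between `u` and `v` is impossible: `x y` is not `u v` itself, so the side of
  -- the triangle that ends at the protruding endpoint would cross `u v`.
  ... | inj₂ u<w | inj₂ w<v with proper
  ...   | inj₁ x≢u = contradiction (inj₁ (p-≤∧≢⇒< x≤u x≢u)) (no-crossing uv (edge-sym G xw) (u<w , w<v))
  ...   | inj₂ y≢v = contradiction (inj₂ (p-≤∧≢⇒< v≤y (≢-sym y≢v))) (no-crossing uv wy (u<w , w<v))

  side : ∀ {u v x} → x ≢ u → x ≢ v → In u v x ⊎ Out u v x
  side {u} {v} {x} x≢u x≢v with ℕ.<-cmp (p x) (p u) | ℕ.<-cmp (p x) (p v)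
  ... | tri< x<u _ _ | _            = inj₂ (inj₁ x<u)
  ... | _            | tri> _ _ v<x = inj₂ (inj₂ v<x)
  ... | tri≈ _ x≡u _ | _            = contradiction (p-injective x≡u) x≢u
  ... | _            | tri≈ _ x≡v _ = contradiction (p-injective x≡v) x≢v
  ... | tri> _ _ u<x | tri< x<v _ _ = inj₁ (u<x , x<v)

  Apex : Fin n → Fin n → Fin n → Set
  Apex u v w = Edge G u w × Edge G v w

  -- Of two apexes on the same side, the one nearer to `u` is cut off from `v` by the edge joining
  -- `u` to the other.
  ¬both-in : ∀ {u v w d} → Apex u v w → Apex u v d → In u v w → In u v d → ¬ p w < p d
  ¬both-in (_ , vw) (ud , _) (u<w , _) (_ , d<v) w<d =
    no-crossing ud (edge-sym G vw) (u<w , w<d) (inj₂ d<v)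

  -- The outer side is one arc of the circle but two intervals of positions, hence the four cases.
  -- One contradicts the order; in the others two sides of the triangles cross.
  ¬both-out : ∀ {u v w d} → p u < p v → Apex u v w → Apex u v d → Out u v w → Out u v d → ¬ p w < p d
  ¬both-out u<v (uw , _) (_ , vd) (inj₁ w<u) (inj₁ d<u) w<d =
    no-crossing (edge-sym G uw) (edge-sym G vd) (w<d , d<u) (inj₂ u<v)
  ¬both-out u<v (_ , vw) (ud , _) (inj₁ w<u) (inj₂ v<d) w<d =
    no-crossing (edge-sym G vw) ud (w<u , u<v) (inj₂ v<d)
  ¬both-out u<v (uw , vw) (ud , vd) (inj₂ v<w) (inj₁ d<u) w<d =
    contradiction (ℕ.<-trans (ℕ.<-trans v<w w<d) d<u) (ℕ.<-asym u<v)
  ¬both-out u<v (uw , _) (_ , vd) (inj₂ v<w) (inj₂ v<d) w<d =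
    no-crossing uw vd (u<v , v<w) (inj₂ w<d)

  opposite-sides : ∀ {u v w d} → p u < p v → w ≢ d → Apex u v w → Apex u v d →
                   (In u v w × Out u v d) ⊎ (Out u v w × In u v d)
  opposite-sides {u} {v} {w} {d} u<v w≢d uvw uvd with apex-side uvw | apex-side uvd
    where
    apex-side : ∀ {x} → Apex u v x → In u v x ⊎ Out u v x
    apex-side (ux , vx) = side (≢-sym (edge-≢ G ux)) (≢-sym (edge-≢ G vx))
  ... | inj₁ w-in  | inj₂ d-out = inj₁ (w-in , d-out)
  ... | inj₂ w-out | inj₁ d-in  = inj₂ (w-out , d-in)
  ... | inj₁ w-in  | inj₁ d-in  with ℕ.<-cmp (p w) (p d)
  ...   | tri< w<d _ _ = contradiction w<d (¬both-in uvw uvd w-in d-in)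
  ...   | tri≈ _ w≡d _ = contradiction (p-injective w≡d) w≢d
  ...   | tri> _ _ d<w = contradiction d<w (¬both-in uvd uvw d-in w-in)
  opposite-sides {u} {v} {w} {d} u<v w≢d uvw uvd | inj₂ w-out | inj₂ d-out with ℕ.<-cmp (p w) (p d)
  ...   | tri< w<d _ _ = contradiction w<d (¬both-out u<v uvw uvd w-out d-out)
  ...   | tri≈ _ w≡d _ = contradiction (p-injective w≡d) w≢d
  ...   | tri> _ _ d<w = contradiction d<w (¬both-out u<v uvd uvw d-out w-out)

module AtLeastThree {n} (G : Graph (3 + n)) (M : MaximalOuterplane G) where
  open MaximalOuterplane M
  open Outerplane G M public

  first last : Fin (3 + n)
  first = vertex-at 0 (s≤s z≤n) .proj₁
  last  = vertex-at (2 + n) (ℕ.n<1+n _) .proj₁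

  p-first : p first ≡ 0
  p-first = vertex-at 0 (s≤s z≤n) .proj₂

  p-last : p last ≡ 2 + n
  p-last = vertex-at (2 + n) (ℕ.n<1+n _) .proj₂

  first≤ : ∀ v → p first ≤ p v
  first≤ v = subst (_≤ p v) (sym p-first) z≤n

  ≤last : ∀ v → p v ≤ p last
  ≤last v = subst (p v ≤_) (sym p-last) (s≤s⁻¹ (toℕ<n (pos v)))

  outer-edge : Edge G first last
  outer-edge = edge-by-maximality (subst (_< p last) (sym p-first) (subst (0 <_) (sym p-last) (s≤s z≤n)))
    λ { {y = y} _ (inj₁ y<first) → ℕ.<⇒≱ y<first (first≤ y)
      ; {y = y} _ (inj₂ last<y)  → ℕ.<⇒≱ last<y (≤last y) }

  inner-vertex : ∃ (In first last)
  inner-vertex with v , eq ← vertex-at 1 (s≤s (s≤s z≤n)) =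
    v , ℕ.≤-reflexive (trans (cong suc p-first) (sym eq)) ,
    subst₂ _<_ (sym eq) (sym p-last) (s≤s (s≤s z≤n))

  -- The chord from `first` to `last` is an edge enclosing all others, so it can seed the shrinking.
  -- Only that chord itself has nothing around it; its triangle lies inside, where a third vertex
  -- exists.
  edge-apex< : ∀ {u v} → p u < p v → Edge G u v → ∃ λ w → Apex u v w
  edge-apex< {u} {v} u<v uv with first ≟ u | last ≟ v
  ... | yes refl | yes refl with w , _ , uw , wv ← inner-apex uv (inner-vertex .proj₂) = w , uw , edge-sym G wv
  ... | no first≢u | _ = enclosed-apex uv u<v first last (<-wellFounded _) outer-edge (first≤ u) (≤last v) (inj₁ first≢u)
  ... | _ | no last≢v  = enclosed-apex uv u<v first last (<-wellFounded _) outer-edge (first≤ u) (≤last v) (inj₂ last≢v)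

  edge-apex : ∀ {u v} → Edge G u v → ∃ λ w → Apex u v w
  edge-apex {u} {v} uv with ℕ.<-cmp (p u) (p v)
  ... | tri< u<v _ _ = edge-apex< u<v uv
  ... | tri≈ _ u≡v _ = contradiction (p-injective u≡v) (edge-≢ G uv)
  ... | tri> _ _ v<u with w , vw , uw ← edge-apex< v<u (edge-sym G uv) = w , uw , vw

  neighbour : ∀ v → ∃ λ w → Edge G v w
  neighbour v with ℕ.m≤n⇒m<n∨m≡n (toℕ<n (pos v))
  ... | inj₁ v<n with w , _ , vw ← successor v v<n = w , vw
  ... | inj₂ v≡n with refl ← p-injective {v} {last} (trans (ℕ.suc-injective v≡n) (sym p-last)) =
    first , edge-sym G outer-edge

-- Orienting a strip of triangles

Arc : ℕ → Set
Arc n = Fin n × Fin n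

bit : Bool → ℕ
bit b = if b then 1 else 0

hits : Arc n → Fin n → ℕ
hits (_ , w) v = bit (does (w ≟ v))

into : List (Arc n) → Fin n → ℕ
into []       v = 0
into (e ∷ as) v = hits e v + into as v

orient : Bool → Fin n → Fin n → Arc n
orient true  u v = u , v
orient false u v = v , u

hits-≢ : ∀ (u : Fin n) {v w} → w ≢ v → hits (u , w) v ≡ 0
hits-≢ u {v} {w} w≢v = cong bit (dec-false (w ≟ v) w≢v)

hits-≡ : ∀ (u v : Fin n) → hits (u , v) v ≡ 1
hits-≡ u v = cong bit (dec-true (v ≟ v) refl)

hits-head : ∀ o {u v : Fin n} → u ≢ v → hits (orient o u v) v ≡ bit o
hits-head true  {u} {v} u≢v = hits-≡ u v
hits-head false {u} {v} u≢v = hits-≢ v u≢v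

hits-tail : ∀ o {u v : Fin n} → u ≢ v → hits (orient o u v) u ≡ bit (not o)
hits-tail true  {u} {v} u≢v = hits-≢ u (≢-sym u≢v)
hits-tail false {u} {v} u≢v = hits-≡ v u

hits-off : ∀ o {u v w : Fin n} → u ≢ w → v ≢ w → hits (orient o u v) w ≡ 0
hits-off true  {u}     u≢w v≢w = hits-≢ u v≢w
hits-off false {v = v} u≢w v≢w = hits-≢ v u≢w

Flip : Arc n → Arc n → Set
Flip e a = a ≡ e ⊎ a ≡ swap e

orient-flip : ∀ o {u v : Fin n} → Flip (u , v) (orient o u v)
orient-flip true  = inj₁ refl
orient-flip false = inj₂ refl

-- c is the newest corner; l tells which of the two older corners stays.
data Strip {n : ℕ} : Fin n → Fin n → Fin n → List (Fin n) → List (Arc n) → Set where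
  triangle : ∀ {a b c} → a ≢ b → a ≢ c → b ≢ c →
             Strip a b c (a ∷ b ∷ c ∷ []) ((a , b) ∷ (a , c) ∷ (b , c) ∷ [])
  extend   : ∀ {a b c d vs es} → Strip a b c vs es → ∀ l → d ∉ vs →
             Strip (if l then b else a) c d (d ∷ vs)
                   (((if l then b else a) , d) ∷ (c , d) ∷ es)

private variable
  vs : List (Fin n)
  es as : List (Arc n)

∉⇒≢ : ∀ {x y : Fin n} → x ∈ vs → y ∉ vs → x ≢ y
∉⇒≢ x∈ y∉ refl = y∉ x∈

corners∈ : Strip a b c vs es → a ∈ vs × b ∈ vs × c ∈ vs
corners∈ (triangle _ _ _)   = here refl , there (here refl) , there (there (here refl))
corners∈ (extend s true  _) with _ , b∈ , c∈ ← corners∈ s = there b∈ , there c∈ , here refl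
corners∈ (extend s false _) with a∈ , _ , c∈ ← corners∈ s = there a∈ , there c∈ , here refl

corners-distinct : Strip a b c vs es → a ≢ b × a ≢ c × b ≢ c
corners-distinct (triangle a≢b a≢c b≢c) = a≢b , a≢c , b≢c
corners-distinct (extend s true d∉)  with corners-distinct s | corners∈ s
... | _ , _ , b≢c | _ , b∈ , c∈ = b≢c , ∉⇒≢ b∈ d∉ , ∉⇒≢ c∈ d∉
corners-distinct (extend s false d∉) with corners-distinct s | corners∈ s
... | _ , a≢c , _ | a∈ , _ , c∈ = a≢c , ∉⇒≢ a∈ d∉ , ∉⇒≢ c∈ d∉

if-elim : ∀ {A : Set} (P : A → Set) l {x y} → P x → P y → P (if l then y else x)
if-elim P true  px py = py
if-elim P false px py = px

pick∈ : Strip a b c vs es → ∀ l → (if l then b else a) ∈ vs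
pick∈ s l = if-elim (_∈ _) l (proj₁ (corners∈ s)) (proj₁ (proj₂ (corners∈ s)))

pick≢ : Strip a b c vs es → ∀ l → (if l then b else a) ≢ c
pick≢ s l = if-elim (_≢ _) l (proj₁ (proj₂ (corners-distinct s))) (proj₂ (proj₂ (corners-distinct s)))

endpoints∈ : Strip a b c vs es → All (λ (u , v) → u ∈ vs × v ∈ vs) es
endpoints∈ s@(triangle _ _ _) with a∈ , b∈ , c∈ ← corners∈ s =
  (a∈ , b∈) ∷ (a∈ , c∈) ∷ (b∈ , c∈) ∷ []
endpoints∈ (extend s l _) =
  (there (pick∈ s l) , here refl) ∷ (there (proj₂ (proj₂ (corners∈ s))) , here refl) ∷
  All.map (λ (u∈ , v∈) → there u∈ , there v∈) (endpoints∈ s)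

Distinct : Arc n → Arc n → Set
Distinct e f = e ≢ f × e ≢ swap f

fresh-distinct : ∀ {x d : Fin n} → d ∉ vs → All (λ (u , v) → u ∈ vs × v ∈ vs) es →
                 All (Distinct (x , d)) es
fresh-distinct d∉ = All.map λ (u∈ , v∈) →
  (λ eq → ∉⇒≢ v∈ d∉ (sym (cong proj₂ eq))) , (λ eq → ∉⇒≢ u∈ d∉ (sym (cong proj₂ eq)))

-- Both added edges end in the fresh vertex, so neither repeats an earlier edge in either direction.
-- Later this makes arcs one-way and lets list counts be indegrees.
simple : Strip a b c vs es → AllPairs Distinct es
simple (triangle a≢b a≢c b≢c) =
  ((b≢c ∘ cong proj₂ , a≢c ∘ cong proj₁) ∷ (a≢b ∘ cong proj₁ , a≢c ∘ cong proj₁) ∷ []) ∷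
  ((a≢b ∘ cong proj₁ , a≢c ∘ cong proj₁) ∷ []) ∷ [] ∷ []
simple (extend s l d∉) =
  ((pick≢ s l ∘ cong proj₁ , ∉⇒≢ (pick∈ s l) d∉ ∘ cong proj₁) ∷ fresh-distinct d∉ (endpoints∈ s)) ∷
  fresh-distinct d∉ (endpoints∈ s) ∷ simple s

-- A slot records the indegree a corner is meant to reach and the one it has now.
Slot Config : Set
Slot   = ℕ × ℕ
Config = Slot × Slot × Slot

-- An oriented prefix of the strip. `proper` compares targets because the indegrees of the three
-- corners may still grow; all other vertices of the prefix already sit at their targets.
record Realises (a b c : Fin n) (vs : List (Fin n)) (es : List (Arc n)) (κ : Config) : Set where
  field
    arcs     : List (Arc n)
    target   : Fin n → ℕ
    flips    : Pointwise Flip es arcs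
    proper   : All (λ (u , v) → target u ≢ target v) es
    bounded  : ∀ v → target v ≤ 4
    corners  : ((target a , into arcs a) , (target b , into arcs b) , (target c , into arcs c)) ≡ κ
    finished : ∀ {v} → v ∈ vs → v ≢ a → v ≢ b → v ≢ c → into arcs v ≡ target v

-- Decidable transitions and the automaton

bools : List Bool
bools = true ∷ false ∷ []

-- The bits orient `a b`, `a c` and `b c`, with `true` pointing to the later corner. Quantifying
-- over an explicit list of eight choices keeps the predicate decidable by evaluation.
Start : Config → Set
Start ((ta , ia) , (tb , ib) , (tc , ic)) =
  ta ≢ tb × ta ≢ tc × tb ≢ tc × ta ≤ 4 × tb ≤ 4 × tc ≤ 4 ×
  Any (λ (o₁ , o₂ , o₃) → (ia , ib , ic) ≡
         (bit (not o₁) + bit (not o₂) , bit o₁ + bit (not o₃) , bit o₂ + bit o₃))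
      (cartesianProduct bools (cartesianProduct bools bools))

-- One triangle is added: b is dropped, so it must have reached its target.
Move : Config → Config → Set
Move ((ta , ia) , (tb , ib) , (tc , ic)) κ′@(_ , _ , (td , _)) =
  ib ≡ tb × ta ≢ td × tc ≢ td × td ≤ 4 ×
  Any (λ (o₁ , o₂) → κ′ ≡ ((ta , bit (not o₁) + ia) , (tc , bit (not o₂) + ic) , (td , bit o₁ + bit o₂)))
      (cartesianProduct bools bools)

swapIf : Bool → Config → Config
swapIf l (α , β , γ) = if l then (β , α , γ) else (α , β , γ)

Done : Config → Set
Done ((ta , ia) , (tb , ib) , (tc , ic)) = ia ≡ ta × ib ≡ tb × ic ≡ tc

_≟ᶜ_ : (κ κ′ : Config) → Dec (κ ≡ κ′)
_≟ᶜ_ = ≡-dec slot (≡-dec slot slot) where slot = ≡-dec ℕ._≟_ ℕ._≟_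

start? : ∀ κ → Dec (Start κ)
start? ((ta , ia) , (tb , ib) , (tc , ic)) =
  ¬? (ta ℕ.≟ tb) ×-dec ¬? (ta ℕ.≟ tc) ×-dec ¬? (tb ℕ.≟ tc) ×-dec
  ta ≤? 4 ×-dec tb ≤? 4 ×-dec tc ≤? 4 ×-dec
  Any.any? (λ _ → ≡-dec ℕ._≟_ (≡-dec ℕ._≟_ ℕ._≟_) _ _) _

move? : ∀ κ κ′ → Dec (Move κ κ′)
move? ((ta , ia) , (tb , ib) , (tc , ic)) κ′@(_ , _ , (td , _)) =
  ib ℕ.≟ tb ×-dec ¬? (ta ℕ.≟ td) ×-dec ¬? (tc ℕ.≟ td) ×-dec td ≤? 4 ×-dec
  Any.any? (λ _ → κ′ ≟ᶜ _) _

done? : ∀ κ → Dec (Done κ)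
done? ((ta , ia) , (tb , ib) , (tc , ic)) = ia ℕ.≟ ta ×-dec ib ℕ.≟ tb ×-dec ic ℕ.≟ tc

-- Found by computer search.  The tables only list enough of the attainable configurations for
-- table-start, table-move and table-done to hold.
next : Fin 4 → Bool → Fin 4
next q false = lookup (# 1 ∷ # 1 ∷ # 3 ∷ # 3 ∷ []) q
next q true  = lookup (# 1 ∷ # 2 ∷ # 2 ∷ # 0 ∷ []) q

table : Fin 4 → List Config
-- State 0 belongs to a single triangle but is also entered from state 3, so its entries have to be
-- valid starts as well as results of moves.
table zero =
  ((2 , 2) , (0 , 0) , (1 , 1)) ∷ ((0 , 0) , (2 , 2) , (1 , 1)) ∷
  ((1 , 1) , (0 , 0) , (4 , 2)) ∷ ((0 , 0) , (1 , 1) , (3 , 2)) ∷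
  ((0 , 0) , (1 , 1) , (2 , 2)) ∷ ((1 , 1) , (0 , 0) , (2 , 2)) ∷
  ((0 , 0) , (1 , 1) , (4 , 2)) ∷ ((1 , 1) , (0 , 0) , (3 , 2)) ∷ []
-- A fan state, preserved by `false`: in every entry the pivot, the first corner, is a source with
-- target 0, so it can bear any number of further edges.
table (suc zero) =
  ((0 , 0) , (1 , 1) , (2 , 2)) ∷ ((0 , 0) , (1 , 1) , (4 , 2)) ∷
  ((0 , 0) , (4 , 2) , (2 , 2)) ∷ ((0 , 0) , (4 , 2) , (3 , 2)) ∷
  ((0 , 0) , (3 , 3) , (1 , 1)) ∷ ((0 , 0) , (2 , 2) , (3 , 2)) ∷ []
table (suc (suc zero)) =
  ((1 , 1) , (4 , 2) , (2 , 2)) ∷ ((1 , 1) , (4 , 2) , (3 , 2)) ∷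
  ((1 , 1) , (2 , 2) , (3 , 2)) ∷ ((2 , 2) , (3 , 3) , (1 , 1)) ∷
  ((4 , 2) , (2 , 2) , (3 , 2)) ∷ ((4 , 2) , (3 , 3) , (1 , 1)) ∷
  ((4 , 3) , (3 , 3) , (0 , 0)) ∷ ((4 , 3) , (3 , 3) , (1 , 0)) ∷
  ((4 , 3) , (3 , 3) , (2 , 0)) ∷ ((3 , 3) , (1 , 1) , (2 , 2)) ∷
  ((3 , 3) , (1 , 1) , (4 , 2)) ∷ []
-- The other fan state, entered from state 2: here the pivot aims at 4, and once it is full all
-- further arcs leave it.
table (suc (suc (suc zero))) =
  ((4 , 2) , (1 , 1) , (3 , 2)) ∷ ((4 , 2) , (3 , 3) , (1 , 1)) ∷
  ((4 , 3) , (3 , 3) , (0 , 0)) ∷ ((4 , 3) , (3 , 3) , (1 , 0)) ∷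
  ((4 , 3) , (3 , 3) , (2 , 0)) ∷ ((4 , 4) , (0 , 0) , (1 , 1)) ∷
  ((4 , 4) , (0 , 0) , (2 , 1)) ∷ ((4 , 4) , (1 , 1) , (0 , 0)) ∷
  ((4 , 4) , (2 , 1) , (0 , 0)) ∷ []

table-start : All Start (table zero)
table-start = from-yes (All.all? start? (table zero))

table-done : ∀ q → Any Done (table q)
table-done = from-yes (Fin.all? λ q → Any.any? done? (table q))

-- The quantifiers run backwards: every listed successor needs a listed predecessor, whereas
-- successors may be left out. This is the direction that keeps all listed configurations realised.
Reaches : Fin 4 → Bool → Set
Reaches q l = All (λ κ′ → Any (λ κ → Move (swapIf l κ) κ′) (table q)) (table (next q l))

reaches? : ∀ q l → Dec (Reaches q l)
reaches? q l = All.all? (λ κ′ → Any.any? (λ κ → move? (swapIf l κ) κ′) (table q)) (table (next q l))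

table-move : ∀ q → Reaches q false × Reaches q true
table-move = from-yes (Fin.all? λ q → reaches? q false ×-dec reaches? q true)

-- Realising the automaton on a strip

private module R = Realises

swap-corners : ∀ {κ} → Realises a b c vs es κ → Realises b a c vs es (swapIf true κ)
swap-corners ρ = record
  { R ρ
  ; corners  = cong (swapIf true) (R.corners ρ)
  ; finished = λ v∈ v≢b v≢a v≢c → R.finished ρ v∈ v≢a v≢b v≢c
  }

-- `Move` always drops the second corner. The two older corners play symmetric roles in `Realises`,
-- so they can be exchanged to make the surviving one first.
turn : ∀ l {κ} → Realises a b c vs es κ →
       Realises (if l then b else a) (if l then a else b) c vs es (swapIf l κ)
turn true  = swap-corners
turn false = id

into-fresh : d ∉ vs → All (λ (u , v) → u ∈ vs × v ∈ vs) es → Pointwise Flip es as → into as d ≡ 0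
into-fresh d∉ [] [] = refl
into-fresh {es = (u , v) ∷ _} d∉ ((u∈ , v∈) ∷ ps) (inj₁ refl ∷ fs) =
  cong₂ _+_ (hits-≢ u (∉⇒≢ v∈ d∉)) (into-fresh d∉ ps fs)
into-fresh {es = (u , v) ∷ _} d∉ ((u∈ , v∈) ∷ ps) (inj₂ refl ∷ fs) =
  cong₂ _+_ (hits-≢ v (∉⇒≢ u∈ d∉)) (into-fresh d∉ ps fs)

different : ∀ {x y p q : ℕ} → x ≡ p → y ≡ q → p ≢ q → x ≢ y
different refl refl p≢q = p≢q

initial : ∀ {κ} → a ≢ b → a ≢ c → b ≢ c → Start κ →
          Realises a b c (a ∷ b ∷ c ∷ []) ((a , b) ∷ (a , c) ∷ (b , c) ∷ []) κ
initial {a = a} {b} {c} {(ta , ia) , (tb , ib) , (tc , ic)} a≢b a≢c b≢c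
        (ta≢tb , ta≢tc , tb≢tc , ta≤ , tb≤ , tc≤ , bits)
  with (o₁ , o₂ , o₃) , eq ← Any.satisfied bits = record
  { arcs     = arcs
  ; target   = t
  ; flips    = orient-flip o₁ ∷ orient-flip o₂ ∷ orient-flip o₃ ∷ []
  ; proper   = different t-a t-b ta≢tb ∷ different t-a t-c ta≢tc ∷ different t-b t-c tb≢tc ∷ []
  ; bounded  = bound
  ; corners  = cong₂ _,_ (cong₂ _,_ t-a (trans into-a (cong proj₁ (sym eq))))
      (cong₂ _,_ (cong₂ _,_ t-b (trans into-b (cong (proj₁ ∘ proj₂) (sym eq))))
                 (cong₂ _,_ t-c (trans into-c (cong (proj₂ ∘ proj₂) (sym eq)))))
  ; finished = λ
      { (here refl)                 v≢a v≢b v≢c → contradiction refl v≢a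
      ; (there (here refl))         v≢a v≢b v≢c → contradiction refl v≢b
      ; (there (there (here refl))) v≢a v≢b v≢c → contradiction refl v≢c
      }
  }
  where
  arcs : List (Arc _)
  arcs = orient o₁ a b ∷ orient o₂ a c ∷ orient o₃ b c ∷ []
  t : Fin _ → ℕ
  -- Vertices outside the triangle get `tc` as a placeholder that satisfies the bound; `advance`
  -- overwrites it when such a vertex enters the strip.
  t v = if does (v ≟ a) then ta else if does (v ≟ b) then tb else tc
  t-a : t a ≡ ta
  t-a rewrite dec-true (a ≟ a) refl = refl
  t-b : t b ≡ tb
  t-b rewrite dec-false (b ≟ a) (≢-sym a≢b) | dec-true (b ≟ b) refl = refl
  t-c : t c ≡ tc
  t-c rewrite dec-false (c ≟ a) (≢-sym a≢c) | dec-false (c ≟ b) (≢-sym b≢c) = refl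
  bound : ∀ v → t v ≤ 4
  bound v with does (v ≟ a) | does (v ≟ b)
  ... | true  | _     = ta≤
  ... | false | true  = tb≤
  ... | false | false = tc≤
  into-a : into arcs a ≡ bit (not o₁) + bit (not o₂)
  into-a rewrite hits-tail o₁ a≢b | hits-tail o₂ a≢c | hits-off o₃ (≢-sym a≢b) (≢-sym a≢c) =
    cong (bit (not o₁) +_) (ℕ.+-identityʳ _)
  into-b : into arcs b ≡ bit o₁ + bit (not o₃)
  into-b rewrite hits-head o₁ a≢b | hits-off o₂ a≢b (≢-sym b≢c) | hits-tail o₃ b≢c =
    cong (bit o₁ +_) (ℕ.+-identityʳ _)
  into-c : into arcs c ≡ bit o₂ + bit o₃
  into-c rewrite hits-off o₁ a≢c b≢c | hits-head o₂ a≢c | hits-head o₃ b≢c =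
    cong (bit o₂ +_) (ℕ.+-identityʳ _)

-- As `d` is fresh, giving it a target leaves the constraints on old edges alone, and its indegree
-- comes from the two new arcs only. The one vertex that newly has to be finished is `b`, which
-- `Move` requires to be at its target.
advance : ∀ {κ κ′} → a ∈ vs → c ∈ vs → a ≢ c → d ∉ vs → All (λ (u , v) → u ∈ vs × v ∈ vs) es →
          (ρ : Realises a b c vs es κ) →
          Move ((R.target ρ a , into (R.arcs ρ) a) , (R.target ρ b , into (R.arcs ρ) b) ,
                (R.target ρ c , into (R.arcs ρ) c)) κ′ →
          Realises a c d (d ∷ vs) ((a , d) ∷ (c , d) ∷ es) κ′
advance {a = a} {c = c} {d = d} {b = b} {κ = κ} {κ′} a∈ c∈ a≢c d∉ ends ρ
        (ib≡tb , ta≢td , tc≢td , td≤ , bits)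
  with (o₁ , o₂) , refl ← Any.satisfied bits = record
  { arcs     = orient o₁ a d ∷ orient o₂ c d ∷ R.arcs ρ
  ; target   = t
  ; flips    = orient-flip o₁ ∷ orient-flip o₂ ∷ R.flips ρ
  ; proper   = different (t-old a∈) t-new ta≢td ∷ different (t-old c∈) t-new tc≢td ∷
               All.zipWith (λ ((u∈ , v∈) , u≢v) → different (t-old u∈) (t-old v∈) u≢v)
                 (ends , R.proper ρ)
  ; bounded  = bound
  ; corners  = cong₂ _,_ (cong₂ _,_ (t-old a∈) into-a)
      (cong₂ _,_ (cong₂ _,_ (t-old c∈) into-c) (cong₂ _,_ t-new into-d))
  ; finished = fin
  }
  where
  a≢d : a ≢ d
  a≢d = ∉⇒≢ a∈ d∉
  c≢d : c ≢ d
  c≢d = ∉⇒≢ c∈ d∉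
  arcs : List (Arc _)
  arcs = orient o₁ a d ∷ orient o₂ c d ∷ R.arcs ρ
  td : ℕ
  td = proj₁ (proj₂ (proj₂ κ′))
  t : Fin _ → ℕ
  t = updateAt (R.target ρ) d (const td)
  t-old : ∀ {v} → v ∈ _ → t v ≡ R.target ρ v
  t-old {v} v∈ = updateAt-minimal v d (R.target ρ) (∉⇒≢ v∈ d∉)
  t-new : t d ≡ td
  t-new = updateAt-updates d (R.target ρ)
  bound : ∀ v → t v ≤ 4
  bound v with v ≟ d
  ... | yes refl = subst (_≤ 4) (sym t-new) td≤
  ... | no v≢d   = subst (_≤ 4) (sym (updateAt-minimal v d (R.target ρ) v≢d)) (R.bounded ρ v)
  into-a : into arcs a ≡ bit (not o₁) + into (R.arcs ρ) a
  into-a rewrite hits-tail o₁ a≢d | hits-off o₂ (≢-sym a≢c) (≢-sym a≢d) = refl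
  into-c : into arcs c ≡ bit (not o₂) + into (R.arcs ρ) c
  into-c rewrite hits-off o₁ a≢c (≢-sym c≢d) | hits-tail o₂ c≢d = refl
  into-d : into arcs d ≡ bit o₁ + bit o₂
  into-d rewrite hits-head o₁ a≢d | hits-head o₂ c≢d | into-fresh d∉ ends (R.flips ρ) =
    cong (bit o₁ +_) (ℕ.+-identityʳ _)
  fin : ∀ {v} → v ∈ d ∷ _ → v ≢ a → v ≢ c → v ≢ d → into arcs v ≡ t v
  fin (here v≡d) _ _ v≢d = contradiction v≡d v≢d
  fin {v} (there v∈) v≢a v≢c v≢d
    rewrite hits-off o₁ (≢-sym v≢a) (≢-sym v≢d) | hits-off o₂ (≢-sym v≢c) (≢-sym v≢d) | t-old v∈
    with v ≟ b
  ... | yes refl = ib≡tb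
  ... | no v≢b   = R.finished ρ v∈ v≢a v≢b v≢c

state : Strip a b c vs es → Fin 4
state (triangle _ _ _) = zero
state (extend s l _)   = next (state s) l

-- All entries are realised at once because each one of the next table may arise from a different
-- entry of the present one.
realise : (s : Strip a b c vs es) → All (Realises a b c vs es) (table (state s))
realise (triangle a≢b a≢c b≢c) = All.map (initial a≢b a≢c b≢c) table-start
realise {es = _ ∷ _ ∷ es} (extend s l d∉) = All.map step (reach l)
  where
  reach : ∀ l → Reaches (state s) l
  reach false = proj₁ (table-move (state s))
  reach true  = proj₂ (table-move (state s))
  step : ∀ {κ′} → Any (λ κ → Move (swapIf l κ) κ′) (table (state s)) → Realises _ _ _ _ _ κ′
  step reachable with κ , κ∈ , move ← find reachable =
    advance (pick∈ s l) (proj₂ (proj₂ (corners∈ s))) (pick≢ s l) d∉ (endpoints∈ s) ρ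
      (subst (λ κ → Move κ _) (sym (R.corners ρ)) move)
    where ρ = turn l (All.lookup (realise s) κ∈)

-- From a list of arcs to an orientation of the graph

flip-distinct : ∀ {e f x y : Arc n} → Flip e x → Flip f y → Distinct e f → Distinct x y
flip-distinct (inj₁ refl) (inj₁ refl) (≢ , ≢s) = ≢ , ≢s
flip-distinct (inj₁ refl) (inj₂ refl) (≢ , ≢s) = ≢s , ≢
flip-distinct (inj₂ refl) (inj₁ refl) (≢ , ≢s) = ≢s ∘ cong swap , ≢ ∘ cong swap
flip-distinct (inj₂ refl) (inj₂ refl) (≢ , ≢s) = ≢ ∘ cong swap , ≢s ∘ cong swap

flip-all : ∀ {e x : Arc n} → Flip e x → Pointwise Flip es as → All (Distinct e) es → All (Distinct x) as
flip-all f []       []       = []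
flip-all f (g ∷ gs) (p ∷ ps) = flip-distinct f g p ∷ flip-all f gs ps

flip-simple : Pointwise Flip es as → AllPairs Distinct es → AllPairs Distinct as
flip-simple []       []       = []
flip-simple (f ∷ fs) (p ∷ ps) = flip-all f fs p ∷ flip-simple fs ps

flip-∈ : ∀ {e : Arc n} → Pointwise Flip es as → e ∈ es → e ∈ as ⊎ swap e ∈ as
flip-∈ (inj₁ refl ∷ fs) (here refl) = inj₁ (here refl)
flip-∈ (inj₂ refl ∷ fs) (here refl) = inj₂ (here refl)
flip-∈ (f ∷ fs) (there e∈) with flip-∈ fs e∈
... | inj₁ p = inj₁ (there p)
... | inj₂ p = inj₂ (there p)

∈-flip : ∀ {x : Arc n} → Pointwise Flip es as → x ∈ as → x ∈ es ⊎ swap x ∈ es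
∈-flip (inj₁ refl ∷ fs) (here refl) = inj₁ (here refl)
∈-flip (inj₂ refl ∷ fs) (here refl) = inj₂ (here refl)
∈-flip (f ∷ fs) (there x∈) with ∈-flip fs x∈
... | inj₁ p = inj₁ (there p)
... | inj₂ p = inj₂ (there p)

antisymmetric : ∀ {u v : Fin n} → AllPairs Distinct as → (u , v) ∈ as → (v , u) ∈ as → u ≡ v
antisymmetric _        (here refl) (here eq)   = sym (cong proj₁ eq)
antisymmetric (p ∷ _)  (here refl) (there v∈)  = contradiction refl (proj₂ (All.lookup p v∈))
antisymmetric (p ∷ _)  (there u∈)  (here refl) = contradiction refl (proj₂ (All.lookup p u∈))
antisymmetric (_ ∷ ps) (there u∈)  (there v∈)  = antisymmetric ps u∈ v∈

_≟ₐ_ : (e f : Arc n) → Dec (e ≡ f)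
_≟ₐ_ = ≡-dec _≟_ _≟_

_∈?_ : (e : Arc n) (as : List (Arc n)) → Dec (e ∈ as)
_∈?_ = DecMembership._∈?_ _≟ₐ_

sum-+ : ∀ {A : Set} (f g : A → ℕ) xs →
        sum (map (λ x → f x + g x) xs) ≡ sum (map f xs) + sum (map g xs)
sum-+ f g []       = refl
sum-+ f g (x ∷ xs) = trans (cong (f x + g x +_) (sum-+ f g xs)) (interchange ℕ.+-commutativeSemigroup (f x) (g x) _ _)

sum-0 : ∀ {A : Set} (xs : List A) → sum (map (const 0) xs) ≡ 0
sum-0 []       = refl
sum-0 (_ ∷ xs) = sum-0 xs

sum-indicator-∉ : ∀ {x : Fin n} {xs} → x ∉ xs → sum (map (λ u → bit (does (u ≟ x))) xs) ≡ 0
sum-indicator-∉ {xs = []}     x∉ = refl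
sum-indicator-∉ {xs = y ∷ xs} x∉ rewrite dec-false (y ≟ _) (x∉ ∘ here ∘ sym) =
  sum-indicator-∉ (x∉ ∘ there)

sum-indicator-∈ : ∀ {x : Fin n} {xs} → Unique xs → x ∈ xs →
                  sum (map (λ u → bit (does (u ≟ x))) xs) ≡ 1
sum-indicator-∈ {x = x} (x∉ ∷ _) (here refl) rewrite dec-true (x ≟ x) refl =
  cong suc (sum-indicator-∉ (All¬⇒¬Any x∉))
sum-indicator-∈ {x = x} {y ∷ _} (y∉ ∷ !xs) (there x∈) rewrite dec-false (y ≟ x) (All.lookup y∉ x∈) =
  sum-indicator-∈ !xs x∈

sum-hits : ∀ (e : Arc n) v → sum (map (λ u → bit (does ((u , v) ≟ₐ e))) (allFin n)) ≡ hits e v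
sum-hits {n} (x , w) v with w ≟ v
... | yes refl = trans
  (cong sum (map-cong (λ u → cong bit (does-⇔ (mk⇔ (cong proj₁) (cong (_, v))) ((u , v) ≟ₐ (x , v)) (u ≟ x))) (allFin n)))
  (sum-indicator-∈ (allFin⁺ n) (∈-allFin x))
... | no w≢v   = trans
  (cong sum (map-cong (λ u → cong bit (dec-false ((u , v) ≟ₐ (x , w)) (w≢v ∘ sym ∘ cong proj₂))) (allFin n)))
  (sum-0 (allFin n))

-- Bridges the two notions of indegree: the sum tests each possible tail for membership, while
-- `into` counts list entries. They agree because no arc is listed twice.
sum-into : AllPairs Distinct as → ∀ v →
           sum (map (λ u → bit (does ((u , v) ∈? as))) (allFin n)) ≡ into as v
sum-into {n} {[]}     _        v = sum-0 (allFin n)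
sum-into {n} {e ∷ as} (e∉ ∷ ps) v = begin
  sum (map (λ u → bit (does ((u , v) ∈? (e ∷ as)))) (allFin n))
    ≡⟨ cong sum (map-cong split (allFin n)) ⟩
  sum (map (λ u → bit (does ((u , v) ≟ₐ e)) + bit (does ((u , v) ∈? as))) (allFin n))
    ≡⟨ sum-+ _ _ (allFin n) ⟩
  sum (map (λ u → bit (does ((u , v) ≟ₐ e))) (allFin n)) + sum (map (λ u → bit (does ((u , v) ∈? as))) (allFin n))
    ≡⟨ cong₂ _+_ (sum-hits e v) (sum-into ps v) ⟩
  hits e v + into as v ∎
  where
  open ≡-Reasoning
  split : ∀ u → bit (does ((u , v) ∈? (e ∷ as))) ≡ bit (does ((u , v) ≟ₐ e)) + bit (does ((u , v) ∈? as))
  split u with (u , v) ≟ₐ e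
  ... | no _     = refl
  ... | yes refl = cong suc (sym (cong bit (dec-false ((u , v) ∈? as) λ e∈ → proj₁ (All.lookup e∉ e∈) refl)))

does-true : ∀ {A : Set} (a? : Dec A) → does a? ≡ true → A
does-true (yes a) _ = a

-- Every table has an entry with all three corners at their targets. In its realisation indegrees
-- and targets coincide at every vertex, so properness and the bound pass from targets to indegrees.
strip-orientation : (G : Graph n) → Strip a b c vs es → (∀ v → v ∈ vs) →
  (∀ {u v} → Edge G u v → (u , v) ∈ es ⊎ (v , u) ∈ es) → (∀ {u v} → (u , v) ∈ es → Edge G u v) →
  ProperOrientationNumber≤ G 4
strip-orientation {n} {a} {b} {c} {es = es} G s spans complete sound
  with κ , κ∈ , done ← find (table-done (state s)) = D , proper , bounded
  where
  ρ : Realises _ _ _ _ _ κ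
  ρ = All.lookup (realise s) κ∈
  simple-arcs : AllPairs Distinct (R.arcs ρ)
  simple-arcs = flip-simple (R.flips ρ) (simple s)

  D : Orientation G
  D .arc u v = does ((u , v) ∈? R.arcs ρ)
  D .arc-edge u v uv with ∈-flip (R.flips ρ) (does-true ((u , v) ∈? R.arcs ρ) uv)
  ... | inj₁ e∈ = sound e∈
  ... | inj₂ e∈ = edge-sym G (sound e∈)
  D .one-way u v uv = [ forward , backward ]′ arc∈
    where
    arc∈ : (u , v) ∈ R.arcs ρ ⊎ (v , u) ∈ R.arcs ρ
    arc∈ with complete uv
    ... | inj₁ e∈ = flip-∈ (R.flips ρ) e∈
    ... | inj₂ e∈ = Sum.swap (flip-∈ (R.flips ρ) e∈)
    forward = λ e∈ → inj₁ (dec-true ((u , v) ∈? _) e∈ ,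
      dec-false ((v , u) ∈? _) (edge-≢ G uv ∘ antisymmetric simple-arcs e∈))
    backward = λ e∈ → inj₂ (dec-false ((u , v) ∈? _) (edge-≢ G (edge-sym G uv) ∘ antisymmetric simple-arcs e∈) ,
      dec-true ((v , u) ∈? _) e∈)

  settled : ∀ v → into (R.arcs ρ) v ≡ R.target ρ v
  settled v with (ia≡ta , ib≡tb , ic≡tc) ← subst Done (sym (R.corners ρ)) done
    with v ≟ a | v ≟ b | v ≟ c
  ... | yes refl | _        | _        = ia≡ta
  ... | _        | yes refl | _        = ib≡tb
  ... | _        | _        | yes refl = ic≡tc
  ... | no v≢a   | no v≢b   | no v≢c   = R.finished ρ (spans v) v≢a v≢b v≢c

  indeg-target : ∀ v → indeg D v ≡ R.target ρ v
  indeg-target v = trans (sum-into simple-arcs v) (settled v)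

  proper : ∀ u v → Edge G u v → indeg D u ≢ indeg D v
  proper u v uv with complete uv
  ... | inj₁ e∈ = different (indeg-target u) (indeg-target v) (All.lookup (R.proper ρ) e∈)
  ... | inj₂ e∈ = different (indeg-target u) (indeg-target v) (≢-sym (All.lookup (R.proper ρ) e∈))

  bounded : ∀ v → indeg D v ≤ 4
  bounded v = subst (_≤ 4) (sym (indeg-target v)) (R.bounded ρ v)

-- The faces along the dual path

-- A face is named by its increasing triple, an order unrelated to the strip. This lists the same
-- three vertices in any order.
record Corners (t : Triple n) (a b c : Fin n) : Set where
  constructor mkCorners
  field
    distinct₁₂ : a ≢ b
    distinct₁₃ : a ≢ c
    distinct₂₃ : b ≢ c
    has₁       : a ∈▵ t
    has₂       : b ∈▵ t
    has₃       : c ∈▵ t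
    only       : ∀ {v} → v ∈▵ t → v ≡ a ⊎ v ≡ b ⊎ v ≡ c

open Corners

rotate : Corners Δ a b c → Corners Δ b c a
rotate κ = mkCorners (distinct₂₃ κ) (≢-sym (distinct₁₂ κ)) (≢-sym (distinct₁₃ κ)) (has₂ κ) (has₃ κ) (has₁ κ)
  ([ inj₂ ∘ inj₂ , [ inj₁ , inj₂ ∘ inj₁ ]′ ]′ ∘ only κ)

reflect : Corners Δ a b c → Corners Δ b a c
reflect κ = mkCorners (≢-sym (distinct₁₂ κ)) (distinct₂₃ κ) (distinct₁₃ κ) (has₂ κ) (has₁ κ) (has₃ κ)
  ([ inj₂ ∘ inj₁ , [ inj₁ , inj₂ ∘ inj₂ ]′ ]′ ∘ only κ)

-- Triangles and their names

module Faces (G : Graph n) where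

  face-corners : IsFace G (x , y , z) → Corners (x , y , z) x y z
  face-corners (_ , _ , xy , yz , xz) = mkCorners (edge-≢ G xy) (edge-≢ G xz) (edge-≢ G yz)
    (inj₁ refl) (inj₂ (inj₁ refl)) (inj₂ (inj₂ refl)) id

  third-corner : IsFace G Δ → u ≢ v → u ∈▵ Δ → v ∈▵ Δ → ∃ (Corners Δ u v)
  third-corner F u≢v (inj₁ refl)        (inj₁ refl)        = contradiction refl u≢v
  third-corner F u≢v (inj₁ refl)        (inj₂ (inj₁ refl)) = _ , face-corners F
  third-corner F u≢v (inj₁ refl)        (inj₂ (inj₂ refl)) = _ , reflect (rotate (rotate (face-corners F)))
  third-corner F u≢v (inj₂ (inj₁ refl)) (inj₁ refl)        = _ , reflect (face-corners F)
  third-corner F u≢v (inj₂ (inj₁ refl)) (inj₂ (inj₁ refl)) = contradiction refl u≢v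
  third-corner F u≢v (inj₂ (inj₁ refl)) (inj₂ (inj₂ refl)) = _ , rotate (face-corners F)
  third-corner F u≢v (inj₂ (inj₂ refl)) (inj₁ refl)        = _ , rotate (rotate (face-corners F))
  third-corner F u≢v (inj₂ (inj₂ refl)) (inj₂ (inj₁ refl)) = _ , reflect (rotate (face-corners F))
  third-corner F u≢v (inj₂ (inj₂ refl)) (inj₂ (inj₂ refl)) = contradiction refl u≢v

  face-edge : IsFace G Δ → u ∈▵ Δ → v ∈▵ Δ → u ≢ v → Edge G u v
  face-edge _                      (inj₁ refl)        (inj₁ refl)        u≢v = contradiction refl u≢v
  face-edge (_ , _ , xy , yz , xz) (inj₁ refl)        (inj₂ (inj₁ refl)) u≢v = xy
  face-edge (_ , _ , xy , yz , xz) (inj₁ refl)        (inj₂ (inj₂ refl)) u≢v = xz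
  face-edge (_ , _ , xy , yz , xz) (inj₂ (inj₁ refl)) (inj₁ refl)        u≢v = edge-sym G xy
  face-edge _                      (inj₂ (inj₁ refl)) (inj₂ (inj₁ refl)) u≢v = contradiction refl u≢v
  face-edge (_ , _ , xy , yz , xz) (inj₂ (inj₁ refl)) (inj₂ (inj₂ refl)) u≢v = yz
  face-edge (_ , _ , xy , yz , xz) (inj₂ (inj₂ refl)) (inj₁ refl)        u≢v = edge-sym G xz
  face-edge (_ , _ , xy , yz , xz) (inj₂ (inj₂ refl)) (inj₂ (inj₁ refl)) u≢v = edge-sym G yz
  face-edge _                      (inj₂ (inj₂ refl)) (inj₂ (inj₂ refl)) u≢v = contradiction refl u≢v

  face-through : Edge G a b → Edge G b c → Edge G a c → ∃ λ t → IsFace G t × a ∈▵ t × b ∈▵ t × c ∈▵ t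
  face-through {a} {b} {c} ab bc ac with Fin.<-cmp a b | Fin.<-cmp b c | Fin.<-cmp a c
  ... | tri≈ _ a≡b _ | _ | _ = contradiction a≡b (edge-≢ G ab)
  ... | _ | tri≈ _ b≡c _ | _ = contradiction b≡c (edge-≢ G bc)
  ... | _ | _ | tri≈ _ a≡c _ = contradiction a≡c (edge-≢ G ac)
  ... | tri< a<b _ _ | tri< b<c _ _ | _ =
    (a , b , c) , (a<b , b<c , ab , bc , ac) , inj₁ refl , inj₂ (inj₁ refl) , inj₂ (inj₂ refl)
  ... | tri< a<b _ _ | tri> _ _ c<b | tri< a<c _ _ =
    (a , c , b) , (a<c , c<b , ac , edge-sym G bc , ab) , inj₁ refl , inj₂ (inj₂ refl) , inj₂ (inj₁ refl)
  ... | tri< a<b _ _ | tri> _ _ c<b | tri> _ _ c<a =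
    (c , a , b) , (c<a , a<b , edge-sym G ac , ab , edge-sym G bc) , inj₂ (inj₁ refl) , inj₂ (inj₂ refl) , inj₁ refl
  ... | tri> _ _ b<a | tri< b<c _ _ | tri< a<c _ _ =
    (b , a , c) , (b<a , a<c , edge-sym G ab , ac , bc) , inj₂ (inj₁ refl) , inj₁ refl , inj₂ (inj₂ refl)
  ... | tri> _ _ b<a | tri< b<c _ _ | tri> _ _ c<a =
    (b , c , a) , (b<c , c<a , bc , edge-sym G ac , edge-sym G ab) , inj₂ (inj₂ refl) , inj₁ refl , inj₂ (inj₁ refl)
  ... | tri> _ _ b<a | tri> _ _ c<b | _ =
    (c , b , a) , (c<b , b<a , edge-sym G bc , edge-sym G ab , edge-sym G ac) ,
    inj₂ (inj₂ refl) , inj₂ (inj₁ refl) , inj₁ refl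

  least : IsFace G (x , y , z) → v ∈▵ (x , y , z) → x Fin.≤ v
  least _                 (inj₁ refl)        = ℕ.≤-refl
  least (x<y , _)         (inj₂ (inj₁ refl)) = ℕ.<⇒≤ x<y
  least (x<y , y<z , _)   (inj₂ (inj₂ refl)) = ℕ.<⇒≤ (ℕ.<-trans x<y y<z)

  greatest : IsFace G (x , y , z) → v ∈▵ (x , y , z) → v Fin.≤ z
  greatest (x<y , y<z , _) (inj₁ refl)        = ℕ.<⇒≤ (ℕ.<-trans x<y y<z)
  greatest (_ , y<z , _)   (inj₂ (inj₁ refl)) = ℕ.<⇒≤ y<z
  greatest _               (inj₂ (inj₂ refl)) = ℕ.≤-refl

  -- Increasing triples with the same vertices agree in minimum and maximum, and then in the
  -- remaining middle entry.
  face-ext : IsFace G Δ → IsFace G Δ′ → (∀ {v} → v ∈▵ Δ → v ∈▵ Δ′) → (∀ {v} → v ∈▵ Δ′ → v ∈▵ Δ) → Δ ≡ Δ′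
  face-ext {Δ = x , y , z} {Δ′ = x′ , y′ , z′} F@(x<y , y<z , _) F′ s⊆t t⊆s
    with refl ← Fin.≤-antisym (least F (t⊆s (inj₁ refl))) (least F′ (s⊆t (inj₁ refl)))
       | refl ← Fin.≤-antisym (greatest F′ (s⊆t (inj₂ (inj₂ refl)))) (greatest F (t⊆s (inj₂ (inj₂ refl))))
    with s⊆t (inj₂ (inj₁ refl))
  ... | inj₁ refl        = contradiction refl (ℕ.<⇒≢ x<y)
  ... | inj₂ (inj₁ refl) = refl
  ... | inj₂ (inj₂ refl) = contradiction refl (ℕ.<⇒≢ y<z)

  corners-edges : IsFace G Δ → Corners Δ a b c → Edge G a b × Edge G b c × Edge G a c
  corners-edges F κ = face-edge F (has₁ κ) (has₂ κ) (distinct₁₂ κ) ,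
    face-edge F (has₂ κ) (has₃ κ) (distinct₂₃ κ) , face-edge F (has₁ κ) (has₃ κ) (distinct₁₃ κ)

  same-apex : IsFace G Δ → IsFace G Δ′ → Corners Δ a b c → Corners Δ′ a b c → Δ ≡ Δ′
  same-apex F F′ κ κ′ = face-ext F F′ (sub κ κ′) (sub κ′ κ)
    where
    sub : ∀ {s t v} → Corners s _ _ _ → Corners t _ _ _ → v ∈▵ s → v ∈▵ t
    sub κ κ′ v∈ with only κ v∈
    ... | inj₁ refl        = has₁ κ′
    ... | inj₂ (inj₁ refl) = has₂ κ′
    ... | inj₂ (inj₂ refl) = has₃ κ′

module DualPath {n m} (G : Graph (3 + n)) (M : MaximalOuterplane G)
  (f : Fin m → Triple (3 + n)) (face : ∀ i → IsFace G (f i)) (f-injective : Injective _≡_ _≡_ f)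
  (dual-adjacent : ∀ i j → toℕ j ≡ suc (toℕ i) → DualAdj (f i) (f j))
  (dual-consecutive : ∀ i j → DualAdj (f i) (f j) → toℕ j ≡ suc (toℕ i) ⊎ toℕ i ≡ suc (toℕ j))
  where

  open AtLeastThree G M
  open Faces G

  ¬sharing : ∀ {i j} → suc (toℕ i) < toℕ j → u ≢ v → u ∈▵ f i → v ∈▵ f i → u ∈▵ f j → v ∈▵ f j → ⊥
  ¬sharing {i = i} {j} i+1<j u≢v ui vi uj vj
    with dual-consecutive i j (fi≢fj , _ , _ , u≢v , ui , vi , uj , vj)
    where
    fi≢fj : f i ≢ f j
    fi≢fj eq with refl ← f-injective eq = ℕ.<-asym (ℕ.n<1+n _) i+1<j
  ... | inj₁ j≡ = ℕ.<⇒≢ i+1<j (sym j≡)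
  ... | inj₂ i≡ = ℕ.<-asym (ℕ.m≤n⇒m≤1+n (ℕ.≤-reflexive (sym i≡))) i+1<j

  in-out : In u v x → ¬ Out u v x
  in-out (u<x , _) (inj₁ x<u) = ℕ.<-asym u<x x<u
  in-out (_ , x<v) (inj₂ v<x) = ℕ.<-asym x<v v<x

  -- The discrete form of separation by a chord: an edge leaving the side anywhere but at `u` or `v`
  -- would cross `u v`.
  in-closed : Edge G u v → Edge G y z → In u v y → z ≡ u ⊎ z ≡ v ⊎ In u v z
  in-closed {u} {v} {z = z} uv yz y-in with z ≟ u | z ≟ v
  ... | yes z≡u | _       = inj₁ z≡u
  ... | _       | yes z≡v = inj₂ (inj₁ z≡v)
  ... | no z≢u  | no z≢v with side z≢u z≢v
  ...   | inj₁ z-in  = inj₂ (inj₂ z-in)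
  ...   | inj₂ z-out = contradiction z-out (no-crossing uv yz y-in)

  out-closed : Edge G u v → Edge G y z → Out u v y → z ≡ u ⊎ z ≡ v ⊎ Out u v z
  out-closed {u} {v} {z = z} uv yz y-out with z ≟ u | z ≟ v
  ... | yes z≡u | _       = inj₁ z≡u
  ... | _       | yes z≡v = inj₂ (inj₁ z≡v)
  ... | no z≢u  | no z≢v with side z≢u z≢v
  ...   | inj₁ z-in  = contradiction y-out (no-crossing uv (edge-sym G yz) z-in)
  ...   | inj₂ z-out = inj₂ (inj₂ z-out)

  module _ {i j} (j≡1+i : toℕ j ≡ suc (toℕ i)) (κ : Corners (f i) u v w) (κ′ : Corners (f j) u v x) where

    spread : (A : Fin (3 + n) → Set) → (∀ {y z} → Edge G y z → A y → z ≡ u ⊎ z ≡ v ⊎ A z) →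
             ∀ {k y z} → A y → y ∈▵ f k → z ∈▵ f k → z ≡ u ⊎ z ≡ v ⊎ A z
    spread A closed {k} {y} {z} Ay y∈ z∈ with y ≟ z
    ... | yes refl = inj₂ (inj₂ Ay)
    ... | no y≢z   = closed (face-edge (face k) y∈ z∈ y≢z) Ay

    k+1<m : ∀ r (k : Fin m) → suc r + toℕ k ≡ toℕ i → suc (toℕ k) < m
    k+1<m r k r+k≡i = ℕ.≤-<-trans (subst (suc (toℕ k) ≤_) r+k≡i (s≤s (ℕ.m≤n+m (toℕ k) r))) (toℕ<n i)

    r+k′≡i : ∀ r (k : Fin m) (r+k≡i : suc r + toℕ k ≡ toℕ i) → r + toℕ (fromℕ< (k+1<m r k r+k≡i)) ≡ toℕ i
    r+k′≡i r k r+k≡i = trans (cong (r +_) (toℕ-fromℕ< (k+1<m r k r+k≡i))) (trans (ℕ.+-suc r (toℕ k)) r+k≡i)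

    -- Such a face would have the edge `u v` in common with `f j`, although `j` is at least two
    -- steps further along the path.
    ¬shared-edge : ∀ r k → suc r + toℕ k ≡ toℕ i → u ∈▵ f k → v ∈▵ f k → ∀ {A : Set} → A
    ¬shared-edge r k r+k≡i uk vk with () ← ¬sharing {i = k} {j}
      (subst (suc (toℕ k) <_) (sym j≡1+i) (s≤s (subst (suc (toℕ k) ≤_) r+k≡i (s≤s (ℕ.m≤n+m (toℕ k) r)))))
      (distinct₁₂ κ) uk vk (has₁ κ′) (has₂ κ′)

    w≢x : w ≢ x
    w≢x refl = contradiction (f-injective (same-apex (face i) (face j) κ κ′)) λ
      { refl → ℕ.<⇒≢ (ℕ.n<1+n _) j≡1+i }

    -- A is the side of the shared edge u v on which w lies.
    one-sided : (A : Fin (3 + n) → Set) → (∀ {y z} → Edge G y z → A y → z ≡ u ⊎ z ≡ v ⊎ A z) → A w →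
                ∀ r k → r + toℕ k ≡ toℕ i → ∀ {z} → z ∈▵ f k → z ≡ u ⊎ z ≡ v ⊎ A z
    one-sided A closed Aw zero k k≡i z∈ with refl ← toℕ-injective k≡i with only κ z∈
    ... | inj₁ z≡u          = inj₁ z≡u
    ... | inj₂ (inj₁ z≡v)   = inj₂ (inj₁ z≡v)
    ... | inj₂ (inj₂ refl)  = inj₂ (inj₂ Aw)
    one-sided A closed Aw (suc r) k r+k≡i
      with _ , y₁ , y₂ , y₁≢y₂ , y₁k , y₂k , y₁k′ , y₂k′ ← dual-adjacent k (fromℕ< (k+1<m r k r+k≡i)) (toℕ-fromℕ< _)
      with one-sided A closed Aw r _ (r+k′≡i r k r+k≡i) y₁k′ | one-sided A closed Aw r _ (r+k′≡i r k r+k≡i) y₂k′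
    -- Walking back from `i`, face `k` has two distinct vertices in common with its successor. They
    -- are not exactly `u` and `v`, so one lies properly in `A` and pulls the whole triangle to that
    -- side.
    ... | inj₂ (inj₂ Ay)   | _                = spread A closed Ay y₁k
    ... | _                | inj₂ (inj₂ Ay)   = spread A closed Ay y₂k
    ... | inj₁ refl        | inj₂ (inj₁ refl) = ¬shared-edge r k r+k≡i y₁k y₂k
    ... | inj₂ (inj₁ refl) | inj₁ refl        = ¬shared-edge r k r+k≡i y₂k y₁k
    ... | inj₁ refl        | inj₁ refl        = contradiction refl y₁≢y₂
    ... | inj₂ (inj₁ refl) | inj₂ (inj₁ refl) = contradiction refl y₁≢y₂

    -- The triangles of `f i` and `f j` lie on opposite sides of their common edge `u v`. All faces
    -- up to `i` stay on the side of `w`, hence none can contain `x`.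
    new-vertex< : p u < p v → ∀ k → toℕ k ≤ toℕ i → ¬ x ∈▵ f k
    new-vertex< u<v k k≤i xk with uv , vw , uw ← corners-edges (face i) κ | _ , vx , ux ← corners-edges (face j) κ′
      with opposite-sides u<v w≢x (uw , vw) (ux , vx)
    ... | inj₁ (w-in , x-out) with one-sided (In u v) (in-closed uv) w-in _ k (ℕ.m∸n+n≡m k≤i) xk
    ...   | inj₁ x≡u         = distinct₁₃ κ′ (sym x≡u)
    ...   | inj₂ (inj₁ x≡v)  = distinct₂₃ κ′ (sym x≡v)
    ...   | inj₂ (inj₂ x-in) = in-out x-in x-out
    new-vertex< u<v k k≤i xk | inj₂ (w-out , x-in) with one-sided (Out u v) (out-closed uv) w-out _ k (ℕ.m∸n+n≡m k≤i) xk
    ...   | inj₁ x≡u          = distinct₁₃ κ′ (sym x≡u)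
    ...   | inj₂ (inj₁ x≡v)   = distinct₂₃ κ′ (sym x≡v)
    ...   | inj₂ (inj₂ x-out) = in-out x-in x-out

  new-vertex : ∀ {i j} → toℕ j ≡ suc (toℕ i) → Corners (f i) u v w → Corners (f j) u v x →
               ∀ k → toℕ k ≤ toℕ i → ¬ x ∈▵ f k
  new-vertex {u = u} {v} j≡1+i κ κ′ with ℕ.<-cmp (p u) (p v)
  ... | tri< u<v _ _ = new-vertex< j≡1+i κ κ′ u<v
  ... | tri≈ _ u≡v _ = contradiction (p-injective u≡v) (distinct₁₂ κ)
  ... | tri> _ _ v<u = new-vertex< j≡1+i (reflect κ) (reflect κ′) v<u

  -- Building the strip along the path

  -- The invariant after face `i`. `visited` serves the freshness of the next vertex, `visits` and
  -- `complete` the final coverage of the graph, and `exit` guarantees that the next face is glued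
  -- along an edge through the tip, as `extend` requires.
  record Stage (i : Fin m) : Set where
    field
      {left right tip} : Fin (3 + n)
      {vertices}       : List (Fin (3 + n))
      {edges}          : List (Arc (3 + n))
      strip    : Strip left right tip vertices edges
      corners  : Corners (f i) left right tip
      visited  : ∀ {v} → v ∈ vertices → ∃ λ k → toℕ k ≤ toℕ i × v ∈▵ f k
      visits   : ∀ {k v} → toℕ k ≤ toℕ i → v ∈▵ f k → v ∈ vertices
      sound    : ∀ {u v} → (u , v) ∈ edges → Edge G u v
      complete : ∀ {k u v} → toℕ k ≤ toℕ i → u ∈▵ f k → v ∈▵ f k → u ≢ v → (u , v) ∈ edges ⊎ (v , u) ∈ edges
      exit     : ∀ j → toℕ j ≡ suc (toℕ i) → ∃ λ l → (if l then right else left) ∈▵ f j × tip ∈▵ f j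

  first-stage : ∀ {i} → toℕ i ≡ 0 → Corners (f i) a b c →
                (∀ j → toℕ j ≡ suc (toℕ i) → b ∈▵ f j × c ∈▵ f j) → Stage i
  first-stage {a} {b} {c} {i} i≡0 κ exits = record
    { strip    = triangle (distinct₁₂ κ) (distinct₁₃ κ) (distinct₂₃ κ)
    ; corners  = κ
    ; visited  = λ
        { (here refl)                 → i , ℕ.≤-refl , has₁ κ
        ; (there (here refl))         → i , ℕ.≤-refl , has₂ κ
        ; (there (there (here refl))) → i , ℕ.≤-refl , has₃ κ }
    ; visits   = λ k≤i v∈ → visits (only κ (only-i k≤i v∈))
    ; sound    = sound
    ; complete = λ k≤i u∈ v∈ → complete (only κ (only-i k≤i u∈)) (only κ (only-i k≤i v∈))
    ; exit     = λ j j≡ → true , exits j j≡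
    }
    where
    only-i : ∀ {k v} → toℕ k ≤ toℕ i → v ∈▵ f k → v ∈▵ f i
    only-i {k} k≤i v∈ with refl ← toℕ-injective {i = k} {i}
      (trans (ℕ.n≤0⇒n≡0 (subst (toℕ k ≤_) i≡0 k≤i)) (sym i≡0)) = v∈
    visits : v ≡ a ⊎ v ≡ b ⊎ v ≡ c → v ∈ a ∷ b ∷ c ∷ []
    visits (inj₁ refl)        = here refl
    visits (inj₂ (inj₁ refl)) = there (here refl)
    visits (inj₂ (inj₂ refl)) = there (there (here refl))
    sides : Edge G a b × Edge G b c × Edge G a c
    sides = corners-edges (face i) κ
    sound : (u , v) ∈ (a , b) ∷ (a , c) ∷ (b , c) ∷ [] → Edge G u v
    sound (here refl)                 = proj₁ sides
    sound (there (here refl))         = proj₂ (proj₂ sides)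
    sound (there (there (here refl))) = proj₁ (proj₂ sides)
    complete : u ≡ a ⊎ u ≡ b ⊎ u ≡ c → v ≡ a ⊎ v ≡ b ⊎ v ≡ c → u ≢ v →
               (u , v) ∈ (a , b) ∷ (a , c) ∷ (b , c) ∷ [] ⊎ (v , u) ∈ (a , b) ∷ (a , c) ∷ (b , c) ∷ []
    complete (inj₁ refl)        (inj₁ refl)        u≢v = contradiction refl u≢v
    complete (inj₁ refl)        (inj₂ (inj₁ refl)) u≢v = inj₁ (here refl)
    complete (inj₁ refl)        (inj₂ (inj₂ refl)) u≢v = inj₁ (there (here refl))
    complete (inj₂ (inj₁ refl)) (inj₁ refl)        u≢v = inj₂ (here refl)
    complete (inj₂ (inj₁ refl)) (inj₂ (inj₁ refl)) u≢v = contradiction refl u≢v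
    complete (inj₂ (inj₁ refl)) (inj₂ (inj₂ refl)) u≢v = inj₁ (there (there (here refl)))
    complete (inj₂ (inj₂ refl)) (inj₁ refl)        u≢v = inj₂ (there (here refl))
    complete (inj₂ (inj₂ refl)) (inj₂ (inj₁ refl)) u≢v = inj₂ (there (there (here refl)))
    complete (inj₂ (inj₂ refl)) (inj₂ (inj₂ refl)) u≢v = contradiction refl u≢v

  next-stage : ∀ {i j} → toℕ j ≡ suc (toℕ i) → Stage i → Stage j
  next-stage {i} {j} j≡1+i σ
    with l , a′∈j , tip∈j ← Stage.exit σ j j≡1+i =
    extended (third-corner (face i) a′≢tip a′∈i (has₃ (Stage.corners σ))) (third-corner (face j) a′≢tip a′∈j tip∈j)
    where
    open Stage σ
    a′ : Fin (3 + n)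
    a′ = if l then right else left
    a′≢tip : a′ ≢ tip
    a′≢tip = pick≢ strip l
    a′∈i : a′ ∈▵ f i
    a′∈i = if-elim (_∈▵ f i) l (has₁ corners) (has₂ corners)
    up-to : ∀ {k} → toℕ k ≤ toℕ j → toℕ k ≤ toℕ i ⊎ k ≡ j
    up-to {k} k≤j with ℕ.m≤n⇒m<n∨m≡n k≤j
    ... | inj₁ k<j = inj₁ (s≤s⁻¹ (subst (toℕ k <_) j≡1+i k<j))
    ... | inj₂ k≡j = inj₂ (toℕ-injective k≡j)
    i≤j : toℕ i ≤ toℕ j
    i≤j = subst (toℕ i ≤_) (sym j≡1+i) (ℕ.n≤1+n _)
    extended : ∃ (Corners (f i) a′ tip) → ∃ (Corners (f j) a′ tip) → Stage j
    extended (_ , κ) (d , κ′) = record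
      { strip    = extend strip l (λ d∈ → let k , k≤i , dk = visited d∈ in new-vertex j≡1+i κ κ′ k k≤i dk)
      ; corners  = κ′
      ; visited  = λ
          { (here refl) → j , ℕ.≤-refl , has₃ κ′
          ; (there v∈)  → let k , k≤i , vk = visited v∈ in k , ℕ.≤-trans k≤i i≤j , vk }
      ; visits   = λ k≤j v∈ → visits′ (up-to k≤j) v∈
      ; sound    = λ
          { (here refl)         → proj₂ (proj₂ sides)
          ; (there (here refl)) → proj₁ (proj₂ sides)
          ; (there (there e∈))  → sound e∈ }
      ; complete = λ k≤j → complete′ (up-to k≤j)
      ; exit     = exit′
      }
      where
      sides : Edge G a′ tip × Edge G tip d × Edge G a′ d
      sides = corners-edges (face j) κ′
      visits′ : ∀ {k} → toℕ k ≤ toℕ i ⊎ k ≡ j → v ∈▵ f k → v ∈ d ∷ vertices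
      visits′ (inj₁ k≤i)  v∈ = there (visits k≤i v∈)
      visits′ (inj₂ refl) v∈ with only κ′ v∈
      ... | inj₁ refl        = there (pick∈ strip l)
      ... | inj₂ (inj₁ refl) = there (proj₂ (proj₂ (corners∈ strip)))
      ... | inj₂ (inj₂ refl) = here refl
      old : (u , v) ∈ edges ⊎ (v , u) ∈ edges →
            (u , v) ∈ (a′ , d) ∷ (tip , d) ∷ edges ⊎ (v , u) ∈ (a′ , d) ∷ (tip , d) ∷ edges
      old = Sum.map (there ∘ there) (there ∘ there)
      complete′ : ∀ {k} → toℕ k ≤ toℕ i ⊎ k ≡ j → u ∈▵ f k → v ∈▵ f k → u ≢ v →
                  (u , v) ∈ (a′ , d) ∷ (tip , d) ∷ edges ⊎ (v , u) ∈ (a′ , d) ∷ (tip , d) ∷ edges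
      complete′ (inj₁ k≤i)  u∈ v∈ u≢v = old (complete k≤i u∈ v∈ u≢v)
      complete′ (inj₂ refl) u∈ v∈ u≢v with only κ′ u∈ | only κ′ v∈
      ... | inj₁ refl        | inj₁ refl        = contradiction refl u≢v
      ... | inj₁ refl        | inj₂ (inj₁ refl) = old (complete ℕ.≤-refl (has₁ κ) (has₂ κ) u≢v)
      ... | inj₁ refl        | inj₂ (inj₂ refl) = inj₁ (here refl)
      ... | inj₂ (inj₁ refl) | inj₁ refl        = old (complete ℕ.≤-refl (has₂ κ) (has₁ κ) u≢v)
      ... | inj₂ (inj₁ refl) | inj₂ (inj₁ refl) = contradiction refl u≢v
      ... | inj₂ (inj₁ refl) | inj₂ (inj₂ refl) = inj₁ (there (here refl))
      ... | inj₂ (inj₂ refl) | inj₁ refl        = inj₂ (here refl)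
      ... | inj₂ (inj₂ refl) | inj₂ (inj₁ refl) = inj₂ (there (here refl))
      ... | inj₂ (inj₂ refl) | inj₂ (inj₂ refl) = contradiction refl u≢v
      -- The edge `a′ tip` already joins `f i` to `f j`, so the face after `j` cannot contain it as
      -- well. The next shared edge therefore passes through `d`, which preserves `exit`.
      ¬skip : ∀ j′ → toℕ j′ ≡ suc (toℕ j) → a′ ∈▵ f j′ → ¬ tip ∈▵ f j′
      ¬skip j′ j′≡ = ¬sharing (subst₂ _<_ j≡1+i (sym j′≡) ℕ.≤-refl) (distinct₁₂ κ) (has₁ κ) (has₂ κ)
      exit′ : ∀ j′ → toℕ j′ ≡ suc (toℕ j) → ∃ λ l → (if l then tip else a′) ∈▵ f j′ × d ∈▵ f j′
      exit′ j′ j′≡ with _ , _ , _ , u≢v , uj , vj , uj′ , vj′ ← dual-adjacent j j′ j′≡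
        with only κ′ uj | only κ′ vj
      ... | inj₁ refl        | inj₁ refl        = contradiction refl u≢v
      ... | inj₁ refl        | inj₂ (inj₁ refl) = contradiction vj′ (¬skip j′ j′≡ uj′)
      ... | inj₁ refl        | inj₂ (inj₂ refl) = false , uj′ , vj′
      ... | inj₂ (inj₁ refl) | inj₁ refl        = contradiction uj′ (¬skip j′ j′≡ vj′)
      ... | inj₂ (inj₁ refl) | inj₂ (inj₁ refl) = contradiction refl u≢v
      ... | inj₂ (inj₁ refl) | inj₂ (inj₂ refl) = true , uj′ , vj′
      ... | inj₂ (inj₂ refl) | inj₁ refl        = false , vj′ , uj′
      ... | inj₂ (inj₂ refl) | inj₂ (inj₁ refl) = true , vj′ , uj′
      ... | inj₂ (inj₂ refl) | inj₂ (inj₂ refl) = contradiction refl u≢v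

  -- In the first triangle no corner is newest by itself, so the second face decides: the edge
  -- shared with it is rotated into the places of `right` and `tip`. For a single face any naming
  -- works.
  initial-stage : ∀ {i} → toℕ i ≡ 0 → Stage i
  initial-stage {i} i≡0 with 1 ℕ.<? m
  ... | yes 1<m
    with _ , _ , _ , u≢v , ui , vi , uj , vj ← dual-adjacent i (fromℕ< 1<m) (trans (toℕ-fromℕ< 1<m) (cong suc (sym i≡0)))
    with _ , κ ← third-corner (face i) u≢v ui vi =
    first-stage i≡0 (rotate (rotate κ)) λ j j≡ →
      let j≡1 = toℕ-injective (trans (toℕ-fromℕ< 1<m) (sym (trans j≡ (cong suc i≡0))))
      in subst (λ j → _ ∈▵ f j) j≡1 uj , subst (λ j → _ ∈▵ f j) j≡1 vj
  ... | no 1≮m = first-stage i≡0 (face-corners (face i)) λ j j≡ →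
    contradiction (subst (_< m) (trans j≡ (cong suc i≡0)) (toℕ<n j)) 1≮m

  stage : ∀ k {i} → toℕ i ≡ k → Stage i
  stage zero    i≡0       = initial-stage i≡0
  stage (suc k) {i} i≡1+k = next-stage (trans i≡1+k (cong suc (sym (toℕ-fromℕ< k<m)))) (stage k (toℕ-fromℕ< k<m))
    where
    k<m : k < m
    k<m = ℕ.<-trans (ℕ.≤-reflexive (sym i≡1+k)) (toℕ<n i)

  module _ (covering : ∀ t → IsFace G t → ∃ λ i → f i ≡ t) where

    edge-face : Edge G u v → ∃ λ k → u ∈▵ f k × v ∈▵ f k
    edge-face uv with w , uw , vw ← edge-apex uv with t , F , ut , vt , _ ← face-through uv vw uw
      with k , refl ← covering t F = k , ut , vt

    last-stage⇒orientation : ∀ {i} → (∀ k → toℕ k ≤ toℕ i) → Stage i → ProperOrientationNumber≤ G 4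
    last-stage⇒orientation k≤i σ = strip-orientation G strip spans complete′ sound
      where
      open Stage σ
      spans : ∀ v → v ∈ vertices
      spans v with w , vw ← neighbour v with k , vk , _ ← edge-face vw = visits (k≤i k) vk
      complete′ : Edge G u v → (u , v) ∈ edges ⊎ (v , u) ∈ edges
      complete′ uv with k , uk , vk ← edge-face uv = complete (k≤i k) uk vk (edge-≢ G uv)

-- Assembly and the small graphs

orientation≤4 : (G : Graph (3 + n)) → MaximalOuterplane G → WeakDualIsPath G → ProperOrientationNumber≤ G 4
-- The path is not empty: vertex `zero` has a neighbour, and the edge between them lies in some
-- face.
orientation≤4 G M (zero , f , face , f-injective , covering , dual)
  with () ← DualPath.edge-face G M f face f-injective (λ ()) (λ ()) covering (proj₂ (AtLeastThree.neighbour G M zero))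
orientation≤4 G M (suc m , f , face , f-injective , covering , dual) =
  last-stage⇒orientation covering k≤last (stage m (toℕ-fromℕ m))
  where
  open DualPath G M f face f-injective (λ i j → proj₂ (dual i j) ∘ inj₁) (λ i j → proj₁ (dual i j))
  k≤last : ∀ k → toℕ k ≤ toℕ (fromℕ m)
  k≤last k = subst (toℕ k ≤_) (sym (toℕ-fromℕ m)) (s≤s⁻¹ (toℕ<n k))

theorem28 : ∀ (n : ℕ) (G : Graph n) → MaximalOuterplane G → WeakDualIsPath G →
    ProperOrientationNumber≤ G 13
theorem28 zero G M path = record { arc = λ () ; arc-edge = λ () ; one-way = λ () } , (λ ()) , λ ()
theorem28 1 G M path =
  record { arc = λ _ _ → false ; arc-edge = λ _ _ () ; one-way = λ { zero zero e → contradiction refl (edge-≢ G e) } } ,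
  (λ { zero zero e → contradiction refl (edge-≢ G e) }) , λ { zero → z≤n }
-- With fewer than three vertices an edge need not lie in a triangle, so no strip is available. The
-- only possible edge is directed away from `zero`, giving indegrees 0 and 1.
theorem28 2 G M path = D , proper , bounded
  where
  D : Orientation G
  D .arc zero (suc zero) = adj G zero (suc zero)
  D .arc _    _          = false
  D .arc-edge zero       (suc zero) e = e
  D .arc-edge zero       zero       ()
  D .arc-edge (suc zero) zero       ()
  D .arc-edge (suc zero) (suc zero) ()
  D .one-way zero       zero       e = contradiction refl (edge-≢ G e)
  D .one-way zero       (suc zero) e = inj₁ (e , refl)
  D .one-way (suc zero) zero       e = inj₂ (refl , edge-sym G e)
  D .one-way (suc zero) (suc zero) e = contradiction refl (edge-≢ G e)
  proper : ∀ u v → Edge G u v → indeg D u ≢ indeg D v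
  proper zero       zero       e = contradiction refl (edge-≢ G e)
  proper zero       (suc zero) e rewrite e = λ ()
  proper (suc zero) zero       e rewrite edge-sym G e = λ ()
  proper (suc zero) (suc zero) e = contradiction refl (edge-≢ G e)
  bounded : ∀ v → indeg D v ≤ 13
  bounded zero = z≤n
  bounded (suc zero) with adj G zero (suc zero)
  ... | true  = s≤s z≤n
  ... | false = z≤n
theorem28 (suc (suc (suc n))) G M path with D , proper , bounded ← orientation≤4 G M path =
  D , proper , λ v → ℕ.≤-trans (bounded v) (ℕ.m≤m+n 4 9)
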